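{- Let $\mathcal X_1,\mathcal X_2,\mathcal Y_1,\mathcal Y_2,\mathcal W_1,\mathcal W_2$ be finite nonempty sets, let $g_1:\mathcal W_1\times\mathcal X_1\to[0,1]$ and $g_2:\mathcal W_2\times\mathcal X_2\to[0,1]$ be gain functions, and let $g:(\mathcal W_1\times\mathcal W_2)\times(\mathcal X_1\times\mathcal X_2)\to[0,1]$ be a joint gain function for $g_1,g_2$. Let $\pi$ be a jointly supported prior on $\mathcal X_1\times\mathcal X_2$ with marginals $\pi_1$ and $\pi_2$, with $V_g(\pi)>0$. Let $(\mathcal X_1,\mathcal Y_1,C_1)$ and $(\mathcal X_2,\mathcal Y_2,C_2)$ be two channels. Then: (1) $I_g(\pi,C_1\times C_2)\ \ge\ I_{g_1}(\pi_1,C_1)+I_{g_2}(\pi_2,C_2)-\log\frac{M^{\max}_{g,\pi}}{M^{\min}_{g,\pi}}$; (2) $I_g(\pi,C_1\times C_2)\ \le\ I_{g_1}(\pi_1,C_1)+I_{g_2}(\pi_2,C_2)+\log\frac{M^{\max}_{g,\pi}}{M^{\min}_{g,\pi}}$.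
   Context: A (discrete) channel $(\mathcal X,\mathcal Y,C)$ consists of finite sets $\mathcal X,\mathcal Y$ and a matrix $C$ with entries $C[x,y]\ge 0$ and $\sum_{y}C[x,y]=1$ for each $x$. A prior on $\mathcal X$ is a probability distribution $\pi$ on $\mathcal X$. The parallel composition (with distinct inputs) $C_1\times C_2$ is the channel from $\mathcal X_1\times\mathcal X_2$ to $\mathcal Y_1\times\mathcal Y_2$ with $(C_1\times C_2)[(x_1,x_2),(y_1,y_2)]=C_1[x_1,y_1]\,C_2[x_2,y_2]$. For a gain function $g:\mathcal W\times\mathcal X\to[0,1]$: $V_g(\pi)=\max_{w\in\mathcal W}\sum_{x}\pi[x]g(w,x)$, $V_g(\pi,C)=\sum_{y}\max_{w\in\mathcal W}\sum_x\pi[x]C[x,y]g(w,x)$, $H_g(\pi)=-\log V_g(\pi)$, $H_g(\pi,C)=-\log V_g(\pi,C)$, and the $g$-leakage is $I_g(\pi,C)=H_g(\pi)-H_g(\pi,C)$. Logarithms are to base 2. A joint gain function $g$ for $g_1,g_2$ is required to satisfy: $g((w_1,w_2),(x_1,x_2))=0$ if and only if $g_1(w_1,x_1)g_2(w_2,x_2)=0$ (no other relation is assumed). The marginals of $\pi$ on $\mathcal X_1\times\mathcal X_2$ are $\pi_1[x_1]=\sum_{x_2}\pi[x_1,x_2]$ and $\pi_2[x_2]=\sum_{x_1}\pi[x_1,x_2]$. $\pi$ is jointly supported if for all $x_1,x_2$, $\pi_1[x_1]\pi_2[x_2]\ne 0$ implies $\pi[x_1,x_2]\neq 0$. For $w_1\in\mathcal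 W_1,w_2\in\mathcal W_2$ let $\mathcal S_{w_1,w_2}=\{(x_1,x_2):\pi[x_1,x_2]\,g((w_1,w_2),(x_1,x_2))\ne0\}$. Define $M^{\min}_{g,\pi}$ (resp. $M^{\max}_{g,\pi}$) as the minimum (resp. maximum), over all $(w_1,w_2)\in\mathcal W_1\times\mathcal W_2$ and all $(x_1,x_2)\in\mathcal S_{w_1,w_2}$, of $$\frac{\pi_1[x_1]g_1(w_1,x_1)\cdot\pi_2[x_2]g_2(w_2,x_2)}{\pi[x_1,x_2]\cdot g((w_1,w_2),(x_1,x_2))}.$$ Pairs $(w_1,w_2)$ with $\mathcal S_{w_1,w_2}=\emptyset$ are ignored; $V_g(\pi)>0$ guarantees that some $\mathcal S_{w_1,w_2}$ is nonempty. -}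

module Defs where

open import Level using (Level; _⊔_) renaming (suc to lsuc)
open import Algebra.Bundles using (CommutativeRing)
open import Data.List.Base using (List; []; _∷_; _++_; map; foldr; filter; cartesianProduct)
open import Data.List.Membership.Propositional.Properties using (∈-cartesianProduct⁺)
open import Data.List.Relation.Unary.Enumerates.Setoid using (IsEnumeration)
open import Data.List.Relation.Unary.Unique.Propositional using (Unique)
open import Data.List.Relation.Unary.Unique.Propositional.Properties using (cartesianProduct⁺)
import Data.List.Extrema as Extrema
open import Data.Product.Base using (_×_; _,_; ∃)
open import Function.Bundles using (_⇔_)
open import Relation.Binary.Core using (Rel)
open import Relation.Binary.Bundles using (DecTotalOrder)
open import Relation.Binary.Structures using (IsDecTotalOrder)
import Relation.Binary.Construct.NonStrictToStrict as NonStrictToStrict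
import Relation.Binary.PropositionalEquality.Core as ≡
import Relation.Binary.PropositionalEquality.Properties as ≡
open import Relation.Nullary.Negation.Core using (¬_)
open import Relation.Nullary.Decidable using (¬?)
open import Relation.Unary using (Pred; Decidable)

-- The real numbers, given axiomatically as a Dedekind-complete ordered
-- field.  As in classical mathematics the order is decidable.  The base-2
-- logarithm is the unique strictly increasing map from the positive reals
-- that turns products into sums and takes the value 1 at 2.

record RealNumbers (c ℓ₁ ℓ₂ : Level) : Set (lsuc (c ⊔ ℓ₁ ⊔ ℓ₂)) where
  field
    commutativeRing : CommutativeRing c ℓ₁

  open CommutativeRing commutativeRing public

  field
    _≤_             : Rel Carrier ℓ₂
    isDecTotalOrder : IsDecTotalOrder _≈_ _≤_

  decTotalOrder : DecTotalOrder c ℓ₁ ℓ₂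
  decTotalOrder = record { isDecTotalOrder = isDecTotalOrder }

  open NonStrictToStrict _≈_ _≤_ public using (_<_)
  open DecTotalOrder decTotalOrder public using (_≥_; _≟_; _≤?_; totalOrder)

  infix 4 _≤_

  field
    0≉1         : ¬ (0# ≈ 1#)
    +-monoˡ-≤   : ∀ z {x y} → x ≤ y → x + z ≤ y + z
    *-nonneg    : ∀ {x y} → 0# ≤ x → 0# ≤ y → 0# ≤ x * y

    -- Total; the value at 0# is unconstrained.
    _⁻¹         : Carrier → Carrier
    ⁻¹-cong     : ∀ {x y} → x ≈ y → x ⁻¹ ≈ y ⁻¹
    ⁻¹-inverseʳ : ∀ {x} → ¬ (x ≈ 0#) → x * x ⁻¹ ≈ 1#

    supremum    : (P : Pred Carrier (c ⊔ ℓ₁ ⊔ ℓ₂)) → ∃ P →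
                  (∃ λ b → ∀ x → P x → x ≤ b) →
                  ∃ λ s → (∀ x → P x → x ≤ s) ×
                          (∀ b → (∀ x → P x → x ≤ b) → s ≤ b)

    -- Total; the values at non-positive arguments are unconstrained.
    log         : Carrier → Carrier
    log-cong    : ∀ {x y} → x ≈ y → log x ≈ log y
    log-mono-<  : ∀ {x y} → 0# < x → x < y → log x < log y
    log-*       : ∀ {x y} → 0# < x → 0# < y → log (x * y) ≈ log x + log y
    log-2       : log (1# + 1#) ≈ 1#

  infix  8 _⁻¹
  infixl 7 _/_

  _/_ : Carrier → Carrier → Carrier
  x / y = x * y ⁻¹

record FiniteSet : Set₁ where
  no-eta-equality
  field
    Element  : Set
    elements : List Element
    complete : IsEnumeration (≡.setoid Element) elements
    unique   : Unique elements
    nonempty : Element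

open FiniteSet public

infixr 2 _×ᶠ_

_×ᶠ_ : FiniteSet → FiniteSet → FiniteSet
(A ×ᶠ B) .Element  = Element A × Element B
(A ×ᶠ B) .elements = cartesianProduct (elements A) (elements B)
(A ×ᶠ B) .complete = λ (a , b) → ∈-cartesianProduct⁺ (complete A a) (complete B b)
(A ×ᶠ B) .unique   = cartesianProduct⁺ (unique A) (unique B)
(A ×ᶠ B) .nonempty = nonempty A , nonempty B

module Leakage {c ℓ₁ ℓ₂ : Level} (ℝ : RealNumbers c ℓ₁ ℓ₂) where

  open RealNumbers ℝ

  private
    variable
      A B : Set

  sumOver : (A → Carrier) → List A → Carrier
  sumOver f xs = foldr _+_ 0# (map f xs)

  infix 5 ∑ Max

  ∑ : (X : FiniteSet) → (Element X → Carrier) → Carrier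
  ∑ X f = sumOver f (elements X)

  syntax ∑ X (λ x → e) = ∑[ x ∈ X ] e

  -- The clauses for [] are placeholders: only nonempty lists are meant.
  maximum minimum : List Carrier → Carrier
  maximum []       = 0#
  maximum (x ∷ xs) = Extrema.max totalOrder x xs
  minimum []       = 0#
  minimum (x ∷ xs) = Extrema.min totalOrder x xs

  Max : (X : FiniteSet) → (Element X → Carrier) → Carrier
  Max X f = maximum (map f (elements X))

  syntax Max X (λ x → e) = max[ x ∈ X ] e

  private
    open DecTotalOrder decTotalOrder using ()
      renaming (refl to ≤-refl; trans to ≤-trans; ≤-respʳ-≈ to ≤-respʳ)
    open import Relation.Binary.Reasoning.Setoid setoid
    open import Algebra.Properties.CommutativeSemigroup +-commutativeSemigroup
      using (interchange)

  sumOver-cong : {f g : A → Carrier} → (∀ x → f x ≈ g x) →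
                 ∀ xs → sumOver f xs ≈ sumOver g xs
  sumOver-cong f≈g []       = refl
  sumOver-cong f≈g (x ∷ xs) = +-cong (f≈g x) (sumOver-cong f≈g xs)

  sumOver-zero : (xs : List A) → sumOver (λ _ → 0#) xs ≈ 0#
  sumOver-zero []       = refl
  sumOver-zero (x ∷ xs) = trans (+-identityˡ _) (sumOver-zero xs)

  sumOver-+ : (f g : A → Carrier) → ∀ xs →
              sumOver (λ x → f x + g x) xs ≈ sumOver f xs + sumOver g xs
  sumOver-+ f g []       = sym (+-identityˡ _)
  sumOver-+ f g (x ∷ xs) = trans (+-congˡ (sumOver-+ f g xs)) (interchange _ _ _ _)

  sumOver-*ˡ : ∀ k (f : A → Carrier) xs →
               sumOver (λ x → k * f x) xs ≈ k * sumOver f xs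
  sumOver-*ˡ k f []       = sym (zeroʳ k)
  sumOver-*ˡ k f (x ∷ xs) =
    trans (+-congˡ (sumOver-*ˡ k f xs)) (sym (distribˡ k _ _))

  sumOver-nonneg : {f : A → Carrier} → (∀ x → 0# ≤ f x) → ∀ xs → 0# ≤ sumOver f xs
  sumOver-nonneg         f≥0 []       = ≤-refl
  sumOver-nonneg {f = f} f≥0 (x ∷ xs) =
    ≤-trans (sumOver-nonneg f≥0 xs)
      (≤-trans (≤-respʳ (sym (+-identityˡ _)) ≤-refl) (+-monoˡ-≤ _ (f≥0 x)))

  sumOver-map-++ : (f : B → Carrier) (h : A → B) → ∀ xs zs →
                   sumOver f (map h xs ++ zs) ≈ sumOver (λ x → f (h x)) xs + sumOver f zs
  sumOver-map-++ f h []       zs = sym (+-identityˡ _)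
  sumOver-map-++ f h (x ∷ xs) zs =
    trans (+-congˡ (sumOver-map-++ f h xs zs)) (sym (+-assoc _ _ _))

  sumOver-cartesianProduct : (f : A × B → Carrier) → ∀ xs ys →
    sumOver f (cartesianProduct xs ys) ≈ sumOver (λ x → sumOver (λ y → f (x , y)) ys) xs
  sumOver-cartesianProduct f []       ys = refl
  sumOver-cartesianProduct f (x ∷ xs) ys =
    trans (sumOver-map-++ f (x ,_) ys _) (+-congˡ (sumOver-cartesianProduct f xs ys))

  sumOver-swap : (f : A → B → Carrier) → ∀ xs ys →
    sumOver (λ x → sumOver (f x) ys) xs ≈ sumOver (λ y → sumOver (λ x → f x y) xs) ys
  sumOver-swap f []       ys = sym (sumOver-zero ys)
  sumOver-swap f (x ∷ xs) ys =
    trans (+-congˡ (sumOver-swap f xs ys)) (sym (sumOver-+ (f x) _ ys))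

  record Prior (X : FiniteSet) : Set (c ⊔ ℓ₁ ⊔ ℓ₂) where
    field
      mass   : Element X → Carrier
      nonneg : ∀ x → 0# ≤ mass x
      total  : ∑[ x ∈ X ] mass x ≈ 1#

    infix 9 _[_]
    _[_] : Element X → Carrier
    _[_] = mass

  record Channel (X Y : FiniteSet) : Set (c ⊔ ℓ₁ ⊔ ℓ₂) where
    field
      entry  : Element X → Element Y → Carrier
      nonneg : ∀ x y → 0# ≤ entry x y
      total  : ∀ x → ∑[ y ∈ Y ] entry x y ≈ 1#

  record GainFunction (W X : FiniteSet) : Set (c ⊔ ℓ₂) where
    field
      gain   : Element W → Element X → Carrier
      nonneg : ∀ w x → 0# ≤ gain w x
      ≤1     : ∀ w x → gain w x ≤ 1#

  open Prior public using (mass; _[_])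
  open Channel public using (entry)
  open GainFunction public using (gain)

  private
    variable
      W W₁ W₂ X X₁ X₂ Y Y₁ Y₂ : FiniteSet

  marginal₁ : Prior (X₁ ×ᶠ X₂) → Prior X₁
  marginal₁ {X₁} {X₂} π = record
    { mass   = λ x₁ → ∑[ x₂ ∈ X₂ ] π [ x₁ , x₂ ]
    ; nonneg = λ x₁ → sumOver-nonneg (λ x₂ → Prior.nonneg π (x₁ , x₂)) (elements X₂)
    ; total  = trans
        (sym (sumOver-cartesianProduct (mass π) (elements X₁) (elements X₂)))
        (Prior.total π)
    }

  marginal₂ : Prior (X₁ ×ᶠ X₂) → Prior X₂
  marginal₂ {X₁} {X₂} π = record
    { mass   = λ x₂ → ∑[ x₁ ∈ X₁ ] π [ x₁ , x₂ ]
    ; nonneg = λ x₂ → sumOver-nonneg (λ x₁ → Prior.nonneg π (x₁ , x₂)) (elements X₁)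
    ; total  = trans
        (sym (sumOver-swap (λ x₁ x₂ → π [ x₁ , x₂ ]) (elements X₁) (elements X₂)))
        (Prior.total (marginal₁ π))
    }

  JointlySupported : Prior (X₁ ×ᶠ X₂) → Set ℓ₁
  JointlySupported π = ∀ x₁ x₂ →
    ¬ (marginal₁ π [ x₁ ] * marginal₂ π [ x₂ ] ≈ 0#) → ¬ (π [ x₁ , x₂ ] ≈ 0#)

  infixr 2 _×ᶜ_

  _×ᶜ_ : Channel X₁ Y₁ → Channel X₂ Y₂ → Channel (X₁ ×ᶠ X₂) (Y₁ ×ᶠ Y₂)
  _×ᶜ_ {Y₁ = Y₁} {Y₂ = Y₂} C₁ C₂ = record
    { entry  = λ (x₁ , x₂) (y₁ , y₂) → entry C₁ x₁ y₁ * entry C₂ x₂ y₂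
    ; nonneg = λ (x₁ , x₂) (y₁ , y₂) →
        *-nonneg (Channel.nonneg C₁ x₁ y₁) (Channel.nonneg C₂ x₂ y₂)
    ; total  = λ (x₁ , x₂) → begin
        ∑[ y ∈ Y₁ ×ᶠ Y₂ ] entries x₁ x₂ y
          ≈⟨ sumOver-cartesianProduct (entries x₁ x₂) (elements Y₁) (elements Y₂) ⟩
        ∑[ y₁ ∈ Y₁ ] (∑[ y₂ ∈ Y₂ ] entry C₁ x₁ y₁ * entry C₂ x₂ y₂)
          ≈⟨ sumOver-cong (λ y₁ → trans
               (sumOver-*ˡ (entry C₁ x₁ y₁) (entry C₂ x₂) (elements Y₂))
               (trans (*-congˡ (Channel.total C₂ x₂)) (*-identityʳ _)))
               (elements Y₁) ⟩
        ∑[ y₁ ∈ Y₁ ] entry C₁ x₁ y₁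
          ≈⟨ Channel.total C₁ x₁ ⟩
        1# ∎
    }
    where
    entries : _ → _ → Element Y₁ × Element Y₂ → Carrier
    entries x₁ x₂ (y₁ , y₂) = entry C₁ x₁ y₁ * entry C₂ x₂ y₂

  IsJointGain : GainFunction W₁ X₁ → GainFunction W₂ X₂ →
                GainFunction (W₁ ×ᶠ W₂) (X₁ ×ᶠ X₂) → Set ℓ₁
  IsJointGain g₁ g₂ g = ∀ w₁ w₂ x₁ x₂ →
    gain g (w₁ , w₂) (x₁ , x₂) ≈ 0# ⇔ gain g₁ w₁ x₁ * gain g₂ w₂ x₂ ≈ 0#

  -- The suffix ᶜ marks the posterior version, relative to a channel.

  V : GainFunction W X → Prior X → Carrier
  V {W} {X} g π = max[ w ∈ W ] ∑[ x ∈ X ] π [ x ] * gain g w x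

  Vᶜ : GainFunction W X → Prior X → Channel X Y → Carrier
  Vᶜ {W} {X} {Y} g π C =
    ∑[ y ∈ Y ] max[ w ∈ W ] ∑[ x ∈ X ] π [ x ] * entry C x y * gain g w x

  H : GainFunction W X → Prior X → Carrier
  H g π = - log (V g π)

  Hᶜ : GainFunction W X → Prior X → Channel X Y → Carrier
  Hᶜ g π C = - log (Vᶜ g π C)

  I : GainFunction W X → Prior X → Channel X Y → Carrier
  I g π C = H g π - Hᶜ g π C

  module _ (g₁ : GainFunction W₁ X₁) (g₂ : GainFunction W₂ X₂)
           (g : GainFunction (W₁ ×ᶠ W₂) (X₁ ×ᶠ X₂)) (π : Prior (X₁ ×ᶠ X₂)) where

    -- (w , x) is InS when x belongs to 𝒮_w.
    InS : Pred (Element ((W₁ ×ᶠ W₂) ×ᶠ (X₁ ×ᶠ X₂))) ℓ₁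
    InS (w , x) = ¬ (π [ x ] * gain g w x ≈ 0#)

    InS? : Decidable InS
    InS? (w , x) = ¬? (π [ x ] * gain g w x ≟ 0#)

    ratio : Element ((W₁ ×ᶠ W₂) ×ᶠ (X₁ ×ᶠ X₂)) → Carrier
    ratio ((w₁ , w₂) , (x₁ , x₂)) =
      ((marginal₁ π [ x₁ ] * gain g₁ w₁ x₁) * (marginal₂ π [ x₂ ] * gain g₂ w₂ x₂))
      / (π [ x₁ , x₂ ] * gain g (w₁ , w₂) (x₁ , x₂))

    ratios : List Carrier
    ratios = map ratio (filter InS? (elements ((W₁ ×ᶠ W₂) ×ᶠ (X₁ ×ᶠ X₂))))

    -- If 0# < V g π, then the list of ratios is nonempty.
    Mᵐⁱⁿ Mᵐᵃˣ : Carrier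
    Mᵐⁱⁿ = minimum ratios
    Mᵐᵃˣ = maximum ratios

{-# OPTIONS --safe #-}
-- On every (w , x) the product of the two marginal scores π₁ g₁ and π₂ g₂ lies
-- between Mᵐⁱⁿ and Mᵐᵃˣ times the joint score π g: off 𝒮 both vanish, because π
-- is jointly supported and g is a joint gain function.  Sums of products over a
-- product set factor, and so do maxima of nonnegative products; hence these
-- bounds pass from scores to vulnerabilities, prior and posterior alike:
--   Mᵐⁱⁿ V_g ≤ V_g₁ V_g₂ ≤ Mᵐᵃˣ V_g.
-- Taking logarithms of both pairs of bounds and subtracting gives the theorem.
module Submission where

open import Defs
open import Level using (Level)
open import Data.Product.Base using (_×_; _,_; ∃; proj₁; proj₂)
open import Data.Sum.Base using (inj₁; inj₂; [_,_]′)
open import Data.List.Base using ([]; _∷_; cartesianProduct)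
open import Data.List.Membership.Propositional using (_∈_; lose)
open import Data.List.Membership.Propositional.Properties using (∈-map⁺; ∈-map⁻; ∈-filter⁺; ∈-filter⁻)
open import Data.List.Relation.Unary.All using (lookup)
open import Data.List.Relation.Unary.Any using (any?; here; there; satisfied)
import Data.List.Extrema as Extrema
open import Function.Base using (id; _∘_)
open import Function.Bundles using (Equivalence)
open import Relation.Binary.Bundles using (DecTotalOrder)
import Relation.Binary.Construct.NonStrictToStrict as NonStrictToStrict
open import Relation.Binary.PropositionalEquality.Core as ≡ using (_≡_)
open import Relation.Nullary.Decidable.Core using (yes; no; decidable-stable)
open import Relation.Nullary.Negation.Core using (¬_; contradiction)
import Algebra.Properties.AbelianGroup as AbelianGroupProperties
import Algebra.Properties.CommutativeSemigroup as CommutativeSemigroupProperties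
import Algebra.Properties.Ring as RingProperties
import Relation.Binary.Reasoning.PartialOrder as PartialOrderReasoning

-- Ordered-field arithmetic, logarithms and differences of bounded quantities.

module OrderedFieldProperties {c ℓ₁ ℓ₂ : Level} (ℝ : RealNumbers c ℓ₁ ℓ₂) where

  open RealNumbers ℝ
  open DecTotalOrder decTotalOrder public using ()
    renaming ( refl to ≤-refl; trans to ≤-trans; reflexive to ≤-reflexive; antisym to ≤-antisym
             ; total to ≤-total; ≤-respʳ-≈ to ≤-respʳ; ≤-respˡ-≈ to ≤-respˡ; poset to ≤-poset )
  open AbelianGroupProperties +-abelianGroup
    using (⁻¹-involutive; ⁻¹-∙-comm; //-rightDividesˡ; //-rightDividesʳ)
  open RingProperties ring using (-1*x≈-x; x[y-z]≈xy-xz)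
  open CommutativeSemigroupProperties +-commutativeSemigroup
    using () renaming (interchange to +-interchange)
  open CommutativeSemigroupProperties *-commutativeSemigroup
    using () renaming (xy∙z≈xz∙y to *-xy∙z≈xz∙y)
  open PartialOrderReasoning ≤-poset

  private
    variable
      x y z u v A a P p M m : Carrier

  <-≤-trans : x < y → y ≤ z → x < z
  <-≤-trans = NonStrictToStrict.<-≤-trans _≈_ _≤_ sym ≤-trans ≤-antisym ≤-respʳ

  <-respʳ : y ≈ z → x < y → x < z
  <-respʳ y≈z x<y = <-≤-trans x<y (≤-reflexive y≈z)

  +-mono-≤ : x ≤ y → u ≤ v → x + u ≤ y + v
  +-mono-≤ {x} {y} {u} {v} x≤y u≤v = begin
    x + u  ≤⟨ +-monoˡ-≤ u x≤y ⟩
    y + u  ≈⟨ +-comm y u ⟩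
    u + y  ≤⟨ +-monoˡ-≤ y u≤v ⟩
    v + y  ≈⟨ +-comm v y ⟩
    y + v  ∎

  x≤z+y⇒x-y≤z : x ≤ z + y → x - y ≤ z
  x≤z+y⇒x-y≤z {y = y} x≤z+y = ≤-respʳ (//-rightDividesʳ y _) (+-monoˡ-≤ (- y) x≤z+y)

  x+y≤z⇒x≤z-y : x + y ≤ z → x ≤ z - y
  x+y≤z⇒x≤z-y {y = y} x+y≤z = ≤-respˡ (//-rightDividesʳ y _) (+-monoˡ-≤ (- y) x+y≤z)

  x≤y⇒0≤y-x : x ≤ y → 0# ≤ y - x
  x≤y⇒0≤y-x x≤y = x+y≤z⇒x≤z-y (≤-respˡ (sym (+-identityˡ _)) x≤y)

  0≤y-x⇒x≤y : 0# ≤ y - x → x ≤ y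
  0≤y-x⇒x≤y {y} {x} 0≤y-x = begin
    x            ≈⟨ +-identityˡ x ⟨
    0# + x       ≤⟨ +-monoˡ-≤ x 0≤y-x ⟩
    (y - x) + x  ≈⟨ //-rightDividesˡ x y ⟩
    y            ∎

  *-monoˡ-≤ : 0# ≤ z → x ≤ y → z * x ≤ z * y
  *-monoˡ-≤ {z} {x} {y} 0≤z x≤y =
    0≤y-x⇒x≤y (≤-respʳ (x[y-z]≈xy-xz z y x) (*-nonneg 0≤z (x≤y⇒0≤y-x x≤y)))

  *-monoʳ-≤ : 0# ≤ z → x ≤ y → x * z ≤ y * z
  *-monoʳ-≤ 0≤z x≤y = ≤-respʳ (*-comm _ _) (≤-respˡ (*-comm _ _) (*-monoˡ-≤ 0≤z x≤y))

  *-mono-≤ : 0# ≤ x → 0# ≤ v → x ≤ y → u ≤ v → x * u ≤ y * v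
  *-mono-≤ 0≤x 0≤v x≤y u≤v = ≤-trans (*-monoˡ-≤ 0≤x u≤v) (*-monoʳ-≤ 0≤v x≤y)

  -- If `1# ≤ 0#`, then `- 1#` is nonnegative, and so is its square, which is `1#` again.
  0≤1 : 0# ≤ 1#
  0≤1 with ≤-total 0# 1#
  ... | inj₁ 0≤1 = 0≤1
  ... | inj₂ 1≤0 = ≤-respʳ (trans (-1*x≈-x (- 1#)) (⁻¹-involutive 1#)) (*-nonneg 0≤-1 0≤-1)
    where
    0≤-1 : 0# ≤ - 1#
    0≤-1 = ≤-respʳ (+-identityˡ _) (x≤y⇒0≤y-x 1≤0)

  -- A nonpositive inverse would make `x * x ⁻¹`, which is `1#`, nonpositive.
  ⁻¹-nonneg : 0# < x → 0# ≤ x ⁻¹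
  ⁻¹-nonneg {x} (0≤x , 0≉x) with ≤-total 0# (x ⁻¹)
  ... | inj₁ 0≤x⁻¹ = 0≤x⁻¹
  ... | inj₂ x⁻¹≤0 = contradiction (≤-antisym 0≤1 1≤0) 0≉1
    where
    1≤0 : 1# ≤ 0#
    1≤0 = begin
      1#        ≈⟨ ⁻¹-inverseʳ (0≉x ∘ sym) ⟨
      x * x ⁻¹  ≤⟨ *-monoˡ-≤ 0≤x x⁻¹≤0 ⟩
      x * 0#    ≈⟨ zeroʳ x ⟩
      0#        ∎

  x/y*y≈x : ¬ (y ≈ 0#) → x / y * y ≈ x
  x/y*y≈x y≉0 =
    trans (*-xy∙z≈xz∙y _ _ _)
      (trans (*-assoc _ _ _) (trans (*-congˡ (⁻¹-inverseʳ y≉0)) (*-identityʳ _)))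

  *≉0 : ¬ (x ≈ 0#) → ¬ (y ≈ 0#) → ¬ (x * y ≈ 0#)
  *≉0 {x} {y} x≉0 y≉0 xy≈0 = x≉0 (begin-equality
    x                ≈⟨ *-identityʳ x ⟨
    x * 1#           ≈⟨ *-congˡ (⁻¹-inverseʳ y≉0) ⟨
    x * (y * y ⁻¹)   ≈⟨ *-assoc x y (y ⁻¹) ⟨
    (x * y) * y ⁻¹   ≈⟨ *-congʳ xy≈0 ⟩
    0# * y ⁻¹        ≈⟨ zeroˡ (y ⁻¹) ⟩
    0#               ∎)

  *-pos : 0# < x → 0# < y → 0# < x * y
  *-pos (0≤x , 0≉x) (0≤y , 0≉y) = *-nonneg 0≤x 0≤y , *≉0 (0≉x ∘ sym) (0≉y ∘ sym) ∘ sym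

  /-pos : 0# < x → 0# < y → 0# < x / y
  /-pos {x} {y} 0<x@(0≤x , 0≉x) 0<y@(_ , 0≉y) = *-nonneg 0≤x (⁻¹-nonneg 0<y) , λ 0≈x/y →
    0≉x (trans (sym (zeroˡ y)) (trans (*-congʳ 0≈x/y) (x/y*y≈x (0≉y ∘ sym))))

  *-pos⁻ˡ : 0# ≤ x → 0# < x * y → 0# < x
  *-pos⁻ˡ 0≤x (_ , 0≉xy) = 0≤x , λ 0≈x → 0≉xy (trans (sym (zeroˡ _)) (*-congʳ 0≈x))

  *-pos⁻ʳ : 0# ≤ y → 0# < x * y → 0# < y
  *-pos⁻ʳ 0≤y 0<xy = *-pos⁻ˡ 0≤y (<-respʳ (*-comm _ _) 0<xy)

  -- The axiom covers only strict inequality; deciding `x ≟ y` leaves the equal case to `log-cong`.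
  log-mono-≤ : 0# < x → x ≤ y → log x ≤ log y
  log-mono-≤ {x} {y} 0<x x≤y with x ≟ y
  ... | yes x≈y = ≤-reflexive (log-cong x≈y)
  ... | no  x≉y = proj₁ (log-mono-< 0<x (x≤y , x≉y))

  log-/ : 0# < x → 0# < y → log (x / y) ≈ log x - log y
  log-/ {x} {y} 0<x 0<y = begin-equality
    log (x / y)                     ≈⟨ //-rightDividesʳ (log y) _ ⟨
    (log (x / y) + log y) - log y   ≈⟨ +-congʳ (log-* (/-pos 0<x 0<y) 0<y) ⟨
    log (x / y * y) - log y         ≈⟨ +-congʳ (log-cong (x/y*y≈x (proj₂ 0<y ∘ sym))) ⟩
    log x - log y                   ∎

  -y--x≈x-y : ∀ x y → - y - - x ≈ x - y
  -y--x≈x-y x y = trans (+-congˡ (⁻¹-involutive x)) (+-comm (- y) x)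

  [x+y]-[u+v]≈[x-u]+[y-v] : ∀ x y u v → (x + y) - (u + v) ≈ (x - u) + (y - v)
  [x+y]-[u+v]≈[x-u]+[y-v] x y u v =
    trans (+-congˡ (sym (⁻¹-∙-comm u v))) (+-interchange x y (- u) (- v))

  -- Meant for logarithms: `P` and `p` come from the products of the component vulnerabilities, `A`
  -- and `a` from the joint ones, capitals being posterior and small letters prior; `M` and `m` come
  -- from the extreme ratios. Pairing `P` with `M` and `m` with `p` lets each hypothesis bound one
  -- bracket. `difference-upper` uses the two opposite bounds.
  difference-lower : P ≤ M + A → m + a ≤ p → (P - p) - (M - m) ≤ A - a
  difference-lower {P} {M} {A} {m} {a} {p} P≤M+A m+a≤p = begin
    (P - p) - (M - m)      ≈⟨ [x+y]-[u+v]≈[x-u]+[y-v] P (- p) M (- m) ⟩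
    (P - M) + (- p - - m)  ≈⟨ +-congˡ (-y--x≈x-y m p) ⟩
    (P - M) + (m - p)      ≤⟨ +-mono-≤ (x≤z+y⇒x-y≤z (≤-respʳ (+-comm M A) P≤M+A))
                                       (x≤z+y⇒x-y≤z m≤-a+p) ⟩
    A - a                  ∎
    where
    m≤-a+p : m ≤ - a + p
    m≤-a+p = ≤-respʳ (+-comm p (- a)) (x+y≤z⇒x≤z-y m+a≤p)

  difference-upper : m + A ≤ P → p ≤ M + a → A - a ≤ (P - p) + (M - m)
  difference-upper {m} {A} {P} {p} {M} {a} m+A≤P p≤M+a = begin
    A - a                  ≤⟨ +-mono-≤ (x+y≤z⇒x≤z-y (≤-respˡ (+-comm m A) m+A≤P))
                                       (x+y≤z⇒x≤z-y -a+p≤M) ⟩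
    (P - m) + (M - p)      ≈⟨ +-congˡ (+-comm M (- p)) ⟩
    (P - m) + (- p + M)    ≈⟨ +-interchange P (- m) (- p) M ⟩
    (P - p) + (- m + M)    ≈⟨ +-congˡ (+-comm (- m) M) ⟩
    (P - p) + (M - m)      ∎
    where
    -a+p≤M : - a + p ≤ M
    -a+p≤M = ≤-respˡ (+-comm p (- a)) (x≤z+y⇒x-y≤z p≤M+a)

-- Sums and maxima over finite sets, and two-sided bounds that pass through them.

module SumMaxProperties {c ℓ₁ ℓ₂ : Level} (ℝ : RealNumbers c ℓ₁ ℓ₂) where

  open RealNumbers ℝ
  open Leakage ℝ
  open OrderedFieldProperties ℝ
  open Extrema totalOrder
  open PartialOrderReasoning ≤-poset

  private
    variable
      A B : Set

  sumOver-mono-≤ : {f h : A → Carrier} → (∀ x → f x ≤ h x) → ∀ xs → sumOver f xs ≤ sumOver h xs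
  sumOver-mono-≤ f≤h []       = ≤-refl
  sumOver-mono-≤ f≤h (x ∷ xs) = +-mono-≤ (f≤h x) (sumOver-mono-≤ f≤h xs)

  ∈⇒≤sumOver : {f : A → Carrier} → (∀ x → 0# ≤ f x) → ∀ {x xs} → x ∈ xs → f x ≤ sumOver f xs
  ∈⇒≤sumOver 0≤f {xs = x ∷ xs} (here ≡.refl) =
    ≤-respˡ (+-identityʳ _) (+-mono-≤ ≤-refl (sumOver-nonneg 0≤f xs))
  ∈⇒≤sumOver 0≤f {xs = x ∷ xs} (there x∈xs) =
    ≤-respˡ (+-identityˡ _) (+-mono-≤ (0≤f x) (∈⇒≤sumOver 0≤f x∈xs))

  sumOver-*ʳ : ∀ k (f : A → Carrier) xs → sumOver (λ x → f x * k) xs ≈ sumOver f xs * k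
  sumOver-*ʳ k f xs =
    trans (sumOver-cong (λ x → *-comm (f x) k) xs) (trans (sumOver-*ˡ k f xs) (*-comm k _))

  sumOver-× : (f : A → Carrier) (h : B → Carrier) → ∀ xs ys →
    sumOver (λ (x , y) → f x * h y) (cartesianProduct xs ys) ≈ sumOver f xs * sumOver h ys
  sumOver-× f h xs ys = begin-equality
    sumOver (λ (x , y) → f x * h y) (cartesianProduct xs ys)
      ≈⟨ sumOver-cartesianProduct _ xs ys ⟩
    sumOver (λ x → sumOver (λ y → f x * h y) ys) xs
      ≈⟨ sumOver-cong (λ x → sumOver-*ˡ (f x) h ys) xs ⟩
    sumOver (λ x → f x * sumOver h ys) xs
      ≈⟨ sumOver-*ʳ _ f xs ⟩
    sumOver f xs * sumOver h ys ∎

  ∈⇒≤maximum : ∀ {x xs} → x ∈ xs → x ≤ maximum xs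
  -- The head is the starting value of the fold, so its bound is separate from that of the tail.
  ∈⇒≤maximum {xs = x ∷ xs} (here ≡.refl) = ⊥≤max x xs
  ∈⇒≤maximum {xs = x ∷ xs} (there y∈xs)  = lookup (xs≤max x xs) y∈xs

  ∈⇒minimum≤ : ∀ {x xs} → x ∈ xs → minimum xs ≤ x
  ∈⇒minimum≤ {xs = x ∷ xs} (here ≡.refl) = min≤⊤ x xs
  ∈⇒minimum≤ {xs = x ∷ xs} (there y∈xs)  = lookup (min≤xs x xs) y∈xs

  -- The fold returns either its starting value or an entry of the tail. The membership hypothesis
  -- rules out the empty list, where `maximum` is a placeholder.
  maximum-∈ : ∀ {x xs} → x ∈ xs → maximum xs ∈ xs
  maximum-∈ {xs = x ∷ xs} _ = [ here , there ]′ (argmax-sel id x xs)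

  minimum-∈ : ∀ {x xs} → x ∈ xs → minimum xs ∈ xs
  minimum-∈ {xs = x ∷ xs} _ = [ here , there ]′ (argmin-sel id x xs)

  ≤Max : ∀ X (f : Element X → Carrier) x → f x ≤ Max X f
  ≤Max X f x = ∈⇒≤maximum (∈-map⁺ f (complete X x))

  Max-attained : ∀ X (f : Element X → Carrier) → ∃ λ x → Max X f ≡ f x
  Max-attained X f
    with x , _ , eq ← ∈-map⁻ f (maximum-∈ (∈-map⁺ f (complete X (nonempty X)))) = x , eq

  Max-nonneg : ∀ X {f : Element X → Carrier} → (∀ x → 0# ≤ f x) → 0# ≤ Max X f
  Max-nonneg X {f} 0≤f = ≤-trans (0≤f (nonempty X)) (≤Max X f (nonempty X))

  -- This bounds the ratio of `b` to `a` by `m` and `M`, with the denominator cleared so that `a`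
  -- may vanish. In use `a` is a joint quantity and `b` the product of its two component quantities.
  Between : (m M a b : Carrier) → Set ℓ₂
  Between m M a b = m * a ≤ b × b ≤ M * a

  private
    variable
      m M a a′ b b′ : Carrier

  between-resp : a ≈ a′ → b ≈ b′ → Between m M a b → Between m M a′ b′
  between-resp a≈a′ b≈b′ (ma≤b , b≤Ma) =
      ≤-respʳ b≈b′ (≤-respˡ (*-congˡ a≈a′) ma≤b)
    , ≤-respˡ b≈b′ (≤-respʳ (*-congˡ a≈a′) b≤Ma)

  between-0 : a ≈ 0# → b ≈ 0# → Between m M a b
  between-0 a≈0 b≈0 = ≤-reflexive (trans (*-congˡ a≈0) (trans (zeroʳ _) (sym b≈0)))
                    , ≤-reflexive (trans b≈0 (sym (trans (*-congˡ a≈0) (zeroʳ _))))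

  -- Serves to attach channel entries to the scores.
  between-scale : ∀ {k} → 0# ≤ k → Between m M a b → Between m M (a * k) (b * k)
  between-scale 0≤k (ma≤b , b≤Ma) = ≤-respˡ (*-assoc _ _ _) (*-monoʳ-≤ 0≤k ma≤b)
                                  , ≤-respʳ (*-assoc _ _ _) (*-monoʳ-≤ 0≤k b≤Ma)

  ∑-between : ∀ X {f h : Element X → Carrier} →
              (∀ x → Between m M (f x) (h x)) → Between m M (∑ X f) (∑ X h)
  ∑-between X f~h =
      ≤-respˡ (sumOver-*ˡ _ _ (elements X)) (sumOver-mono-≤ (proj₁ ∘ f~h) (elements X))
    , ≤-respʳ (sumOver-*ˡ _ _ (elements X)) (sumOver-mono-≤ (proj₂ ∘ f~h) (elements X))

  ∑-between-× : ∀ X Y {f : Element (X ×ᶠ Y) → Carrier} {f₁ : Element X → Carrier}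
                {f₂ : Element Y → Carrier} →
                (∀ x y → Between m M (f (x , y)) (f₁ x * f₂ y)) →
                Between m M (∑ (X ×ᶠ Y) f) (∑ X f₁ * ∑ Y f₂)
  ∑-between-× X Y {f₁ = f₁} {f₂} f~f₁f₂ =
    between-resp refl (sumOver-× f₁ f₂ (elements X) (elements Y))
      (∑-between (X ×ᶠ Y) (λ (x , y) → f~f₁f₂ x y))

  -- For the lower bound, evaluate at a maximiser of `f`; by nonnegativity the two factors there
  -- grow to their own maxima. For the upper bound, the separate maximisers of `f₁` and `f₂` form a
  -- pair that competes in the joint maximum, and `0# ≤ M` keeps the order.
  Max-between-× : ∀ X Y {f : Element (X ×ᶠ Y) → Carrier} {f₁ : Element X → Carrier}
                  {f₂ : Element Y → Carrier} → 0# ≤ M →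
                  (∀ x → 0# ≤ f₁ x) → (∀ y → 0# ≤ f₂ y) →
                  (∀ x y → Between m M (f (x , y)) (f₁ x * f₂ y)) →
                  Between m M (Max (X ×ᶠ Y) f) (Max X f₁ * Max Y f₂)
  Max-between-× {M} {m} X Y {f} {f₁} {f₂} 0≤M 0≤f₁ 0≤f₂ f~f₁f₂ = lower , upper
    where
    lower : m * Max (X ×ᶠ Y) f ≤ Max X f₁ * Max Y f₂
    lower with (x , y) , eq ← Max-attained (X ×ᶠ Y) f = begin
      m * Max (X ×ᶠ Y) f     ≡⟨ ≡.cong (m *_) eq ⟩
      m * f (x , y)          ≤⟨ proj₁ (f~f₁f₂ x y) ⟩
      f₁ x * f₂ y            ≤⟨ *-mono-≤ (0≤f₁ x) (Max-nonneg Y 0≤f₂) (≤Max X f₁ x) (≤Max Y f₂ y) ⟩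
      Max X f₁ * Max Y f₂    ∎

    upper : Max X f₁ * Max Y f₂ ≤ M * Max (X ×ᶠ Y) f
    upper with x , eq₁ ← Max-attained X f₁ | y , eq₂ ← Max-attained Y f₂ = begin
      Max X f₁ * Max Y f₂    ≡⟨ ≡.cong₂ _*_ eq₁ eq₂ ⟩
      f₁ x * f₂ y            ≤⟨ proj₂ (f~f₁f₂ x y) ⟩
      M * f (x , y)          ≤⟨ *-monoˡ-≤ 0≤M (≤Max (X ×ᶠ Y) f (x , y)) ⟩
      M * Max (X ×ᶠ Y) f     ∎

  log-between : 0# < m → 0# < M → 0# < a → 0# < b → 0# < b′ → Between m M a (b * b′) →
                (log m + log a ≤ log b + log b′) × (log b + log b′ ≤ log M + log a)
  log-between 0<m 0<M 0<a 0<b 0<b′ (lower , upper) =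
      ≤-respʳ (log-* 0<b 0<b′) (≤-respˡ (log-* 0<m 0<a) (log-mono-≤ (*-pos 0<m 0<a) lower))
    , ≤-respˡ (log-* 0<b 0<b′) (≤-respʳ (log-* 0<M 0<a) (log-mono-≤ (*-pos 0<b 0<b′) upper))

-- Marginal masses, and prior against posterior vulnerability.

module LeakageProperties {c ℓ₁ ℓ₂ : Level} (ℝ : RealNumbers c ℓ₁ ℓ₂) where

  open RealNumbers ℝ
  open Leakage ℝ
  open OrderedFieldProperties ℝ
  open SumMaxProperties ℝ
  open CommutativeSemigroupProperties *-commutativeSemigroup
    using () renaming (interchange to *-interchange; xy∙z≈xz∙y to *-xy∙z≈xz∙y)
  open PartialOrderReasoning ≤-poset

  private
    variable
      W X Y : FiniteSet

  -- The mass is one of the nonnegative terms of the marginal. Hence a positive joint mass makes the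
  -- marginal positive.
  mass≤marginal₁ : ∀ {X₁ X₂} (π : Prior (X₁ ×ᶠ X₂)) x₁ x₂ → π [ x₁ , x₂ ] ≤ marginal₁ π [ x₁ ]
  mass≤marginal₁ {X₂ = X₂} π x₁ x₂ =
    ∈⇒≤sumOver (λ x₂′ → Prior.nonneg π (x₁ , x₂′)) (complete X₂ x₂)

  mass≤marginal₂ : ∀ {X₁ X₂} (π : Prior (X₁ ×ᶠ X₂)) x₁ x₂ → π [ x₁ , x₂ ] ≤ marginal₂ π [ x₂ ]
  mass≤marginal₂ {X₁} π x₁ x₂ =
    ∈⇒≤sumOver (λ x₁′ → Prior.nonneg π (x₁′ , x₂)) (complete X₁ x₁)

  score-nonneg : (g : GainFunction W X) (π : Prior X) → ∀ w x → 0# ≤ π [ x ] * gain g w x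
  score-nonneg g π w x = *-nonneg (Prior.nonneg π x) (GainFunction.nonneg g w x)

  expectedGain-nonneg : (g : GainFunction W X) (π : Prior X) →
                        ∀ w → 0# ≤ ∑ X (λ x → π [ x ] * gain g w x)
  expectedGain-nonneg {X = X} g π w = sumOver-nonneg (score-nonneg g π w) (elements X)

  expectedGainᶜ-nonneg : (g : GainFunction W X) (π : Prior X) (C : Channel X Y) →
                         ∀ y w → 0# ≤ ∑ X (λ x → π [ x ] * entry C x y * gain g w x)
  expectedGainᶜ-nonneg {X = X} g π C y w =
    sumOver-nonneg
      (λ x → *-nonneg (*-nonneg (Prior.nonneg π x) (Channel.nonneg C x y)) (GainFunction.nonneg g w x))
      (elements X)

  V-nonneg : (g : GainFunction W X) (π : Prior X) → 0# ≤ V g π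
  V-nonneg {W} g π = Max-nonneg W (expectedGain-nonneg g π)

  -- An action optimal for the prior remains available after every output, and since the rows of `C`
  -- sum to `1#`, its expected gain is the sum of its contributions over the outputs. This carries
  -- positivity from prior to posterior vulnerabilities, so that their logarithms can be handled.
  V≤Vᶜ : (g : GainFunction W X) (π : Prior X) (C : Channel X Y) → V g π ≤ Vᶜ g π C
  V≤Vᶜ {W} {X} {Y} g π C with w , eq ← Max-attained W (λ w → ∑ X (λ x → π [ x ] * gain g w x)) = begin
    V g π
      ≡⟨ eq ⟩
    ∑ X (λ x → π [ x ] * gain g w x)
      ≈⟨ sumOver-cong (λ x → trans (sym (*-identityʳ _))
           (trans (*-congˡ (sym (Channel.total C x))) (sym (sumOver-*ˡ _ _ (elements Y))))) (elements X) ⟩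
    ∑ X (λ x → ∑ Y (λ y → π [ x ] * gain g w x * entry C x y))
      ≈⟨ sumOver-cong (λ x → sumOver-cong (λ y → *-xy∙z≈xz∙y _ _ _) (elements Y)) (elements X) ⟩
    ∑ X (λ x → ∑ Y (λ y → π [ x ] * entry C x y * gain g w x))
      ≈⟨ sumOver-swap _ (elements X) (elements Y) ⟩
    ∑ Y (λ y → ∑ X (λ x → π [ x ] * entry C x y * gain g w x))
      ≤⟨ sumOver-mono-≤ (λ y → ≤Max W _ w) (elements Y) ⟩
    Vᶜ g π C ∎

  I≈logVᶜ-logV : (g : GainFunction W X) (π : Prior X) (C : Channel X Y) →
                 I g π C ≈ log (Vᶜ g π C) - log (V g π)
  I≈logVᶜ-logV g π C = -y--x≈x-y (log (Vᶜ g π C)) (log (V g π))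

  -- Joint scores compared with products of marginal scores.

  module _ {X₁ X₂ W₁ W₂ : FiniteSet}
           (g₁ : GainFunction W₁ X₁) (g₂ : GainFunction W₂ X₂)
           (g : GainFunction (W₁ ×ᶠ W₂) (X₁ ×ᶠ X₂)) (joint : IsJointGain g₁ g₂ g)
           (π : Prior (X₁ ×ᶠ X₂)) (supported : JointlySupported π) where

    private
      π₁ : Prior X₁
      π₁ = marginal₁ π

      π₂ : Prior X₂
      π₂ = marginal₂ π

      WX : FiniteSet
      WX = (W₁ ×ᶠ W₂) ×ᶠ (X₁ ×ᶠ X₂)

      mᴹ Mᴹ : Carrier
      mᴹ = Mᵐⁱⁿ g₁ g₂ g π
      Mᴹ = Mᵐᵃˣ g₁ g₂ g π

      score scores : Element WX → Carrier
      score (w , x) = π [ x ] * gain g w x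
      scores ((w₁ , w₂) , (x₁ , x₂)) = (π₁ [ x₁ ] * gain g₁ w₁ x₁) * (π₂ [ x₂ ] * gain g₂ w₂ x₂)

    ratio-∈ : ∀ e → InS g₁ g₂ g π e → ratio g₁ g₂ g π e ∈ ratios g₁ g₂ g π
    ratio-∈ e s = ∈-map⁺ (ratio g₁ g₂ g π) (∈-filter⁺ (InS? g₁ g₂ g π) (complete WX e) s)

    -- By contraposition: regrouped as masses times gains, a nonzero product has nonzero `π` by
    -- joint support and nonzero `g` by the joint gain condition. Decidable equality removes the
    -- double negation.
    scores≈0 : ∀ e → ¬ InS g₁ g₂ g π e → scores e ≈ 0#
    scores≈0 ((w₁ , w₂) , (x₁ , x₂)) ¬s =
      trans (*-interchange _ _ _ _) (decidable-stable (_ ≟ 0#) λ ≉0 →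
        ¬s (*≉0 (supported x₁ x₂ (λ ≈0 → ≉0 (trans (*-congʳ ≈0) (zeroˡ _))))
                (λ g≈0 → ≉0 (trans (*-congˡ (Equivalence.to (joint w₁ w₂ x₁ x₂) g≈0)) (zeroʳ _)))))

    -- A nonzero score has positive `π`, which lies below both marginals, and nonzero `g`, so the
    -- joint gain condition makes both component gains nonzero.
    scores-pos : ∀ e → InS g₁ g₂ g π e → 0# < scores e
    scores-pos ((w₁ , w₂) , (x₁ , x₂)) s =
        *-nonneg (score-nonneg g₁ π₁ w₁ x₁) (score-nonneg g₂ π₂ w₂ x₂)
      , λ 0≈ → *≉0 (*≉0 π₁≉0 π₂≉0) g₁g₂≉0 (trans (*-interchange _ _ _ _) (sym 0≈))
      where
      0<π : 0# < π [ x₁ , x₂ ]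
      0<π = Prior.nonneg π _ , λ 0≈π → s (trans (*-congʳ (sym 0≈π)) (zeroˡ _))

      π₁≉0 : ¬ (π₁ [ x₁ ] ≈ 0#)
      π₁≉0 = proj₂ (<-≤-trans 0<π (mass≤marginal₁ π x₁ x₂)) ∘ sym

      π₂≉0 : ¬ (π₂ [ x₂ ] ≈ 0#)
      π₂≉0 = proj₂ (<-≤-trans 0<π (mass≤marginal₂ π x₁ x₂)) ∘ sym

      g₁g₂≉0 : ¬ (gain g₁ w₁ x₁ * gain g₂ w₂ x₂ ≈ 0#)
      g₁g₂≉0 ≈0 = s (trans (*-congˡ (Equivalence.from (joint w₁ w₂ x₁ x₂) ≈0)) (zeroʳ _))

    ratio-pos : ∀ e → InS g₁ g₂ g π e → 0# < ratio g₁ g₂ g π e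
    ratio-pos e@(w , x) s = /-pos (scores-pos e s) (score-nonneg g π w x , s ∘ sym)

    scores-between : ∀ e → Between mᴹ Mᴹ (score e) (scores e)
    scores-between e@(w , x) with score e ≟ 0#
    ... | yes ≈0 = between-0 ≈0 (scores≈0 e (λ s → s ≈0))
    -- The ratio at `e` is in the list, hence between its extremes; multiplying by the score clears
    -- the denominator.
    ... | no  s  =
        ≤-respʳ (x/y*y≈x s) (*-monoʳ-≤ (score-nonneg g π w x) (∈⇒minimum≤ (ratio-∈ e s)))
      , ≤-respˡ (x/y*y≈x s) (*-monoʳ-≤ (score-nonneg g π w x) (∈⇒≤maximum (ratio-∈ e s)))

    -- Otherwise every score, and with it `V g π`, would be zero. This ensures that the extreme
    -- ratios are not the placeholders for empty lists.
    InS-nonempty : 0# < V g π → ∃ (InS g₁ g₂ g π)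
    InS-nonempty (_ , 0≉V) with any? (InS? g₁ g₂ g π) (elements WX)
    ... | yes s = satisfied s
    ... | no ¬s = contradiction (sym V≈0) 0≉V
      where
      score≈0 : ∀ e → score e ≈ 0#
      score≈0 e = decidable-stable (score e ≟ 0#) (¬s ∘ lose (complete WX e))

      V≈0 : V g π ≈ 0#
      V≈0 with w , eq ← Max-attained (W₁ ×ᶠ W₂) (λ w → ∑ (X₁ ×ᶠ X₂) (λ x → score (w , x))) = begin-equality
        V g π                                   ≡⟨ eq ⟩
        ∑ (X₁ ×ᶠ X₂) (λ x → score (w , x))      ≈⟨ sumOver-cong (λ x → score≈0 (w , x)) (elements (X₁ ×ᶠ X₂)) ⟩
        ∑ (X₁ ×ᶠ X₂) (λ _ → 0#)                 ≈⟨ sumOver-zero (elements (X₁ ×ᶠ X₂)) ⟩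
        0#                                      ∎

    ∈ratios⇒pos : ∀ {r} → r ∈ ratios g₁ g₂ g π → 0# < r
    ∈ratios⇒pos r∈ with e , e∈ , ≡.refl ← ∈-map⁻ (ratio g₁ g₂ g π) r∈ =
      ratio-pos e (proj₂ (∈-filter⁻ (InS? g₁ g₂ g π) {xs = elements WX} e∈))

    -- The minimum of a nonempty list is one of its entries, and every ratio is positive.
    Mᵐⁱⁿ-pos : 0# < V g π → 0# < mᴹ
    Mᵐⁱⁿ-pos 0<V with e , s ← InS-nonempty 0<V = ∈ratios⇒pos (minimum-∈ (ratio-∈ e s))

    Mᵐᵃˣ-pos : 0# < V g π → 0# < Mᴹ
    Mᵐᵃˣ-pos 0<V with e , s ← InS-nonempty 0<V = ∈ratios⇒pos (maximum-∈ (ratio-∈ e s))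

    V-between : 0# < V g π → Between mᴹ Mᴹ (V g π) (V g₁ π₁ * V g₂ π₂)
    V-between 0<V = Max-between-× W₁ W₂ (proj₁ (Mᵐᵃˣ-pos 0<V))
      (expectedGain-nonneg g₁ π₁) (expectedGain-nonneg g₂ π₂)
      (λ w₁ w₂ → ∑-between-× X₁ X₂ (λ x₁ x₂ → scores-between ((w₁ , w₂) , (x₁ , x₂))))

    Vᶜ-between : ∀ {Y₁ Y₂} → 0# < V g π → (C₁ : Channel X₁ Y₁) (C₂ : Channel X₂ Y₂) →
                 Between mᴹ Mᴹ (Vᶜ g π (C₁ ×ᶜ C₂)) (Vᶜ g₁ π₁ C₁ * Vᶜ g₂ π₂ C₂)
    Vᶜ-between {Y₁} {Y₂} 0<V C₁ C₂ = ∑-between-× Y₁ Y₂ λ y₁ y₂ →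
      Max-between-× W₁ W₂ (proj₁ (Mᵐᵃˣ-pos 0<V))
        (expectedGainᶜ-nonneg g₁ π₁ C₁ y₁) (expectedGainᶜ-nonneg g₂ π₂ C₂ y₂)
        (λ w₁ w₂ → ∑-between-× X₁ X₂ (λ x₁ x₂ →
          -- Both sides carry the same factor `C₁ C₂`. It is attached last by `between-scale`; the
          -- regrouping moves each entry between mass and gain, as in `Vᶜ`.
          between-resp (*-xy∙z≈xz∙y _ _ _)
            (trans (*-interchange _ _ _ _) (*-cong (*-xy∙z≈xz∙y _ _ _) (*-xy∙z≈xz∙y _ _ _)))
            (between-scale (Channel.nonneg (C₁ ×ᶜ C₂) (x₁ , x₂) (y₁ , y₂))
              (scores-between ((w₁ , w₂) , (x₁ , x₂))))))

-- From bounds on vulnerabilities to bounds on leakage.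

theorem3p9 :
  {c ℓ₁ ℓ₂ : Level} (ℝ : RealNumbers c ℓ₁ ℓ₂) →
  let open RealNumbers ℝ
      open Leakage ℝ
  in
  (X₁ X₂ Y₁ Y₂ W₁ W₂ : FiniteSet)
  (g₁ : GainFunction W₁ X₁) (g₂ : GainFunction W₂ X₂)
  (g : GainFunction (W₁ ×ᶠ W₂) (X₁ ×ᶠ X₂)) →
  IsJointGain g₁ g₂ g →
  (π : Prior (X₁ ×ᶠ X₂)) →
  JointlySupported π →
  0# < V g π →
  (C₁ : Channel X₁ Y₁) (C₂ : Channel X₂ Y₂) →
  let π₁   = marginal₁ π
      π₂   = marginal₂ π
      logM = log (Mᵐᵃˣ g₁ g₂ g π / Mᵐⁱⁿ g₁ g₂ g π)
  in
  (I g π (C₁ ×ᶜ C₂) ≥ (I g₁ π₁ C₁ + I g₂ π₂ C₂) - logM)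
  × (I g π (C₁ ×ᶜ C₂) ≤ (I g₁ π₁ C₁ + I g₂ π₂ C₂) + logM)
theorem3p9 ℝ X₁ X₂ Y₁ Y₂ W₁ W₂ g₁ g₂ g joint π supported 0<V C₁ C₂ =
    (begin
      (I g₁ π₁ C₁ + I g₂ π₂ C₂) - logM           ≈⟨ +-cong I₁+I₂≈ (-‿cong logM≈) ⟩
      -- The upper bound on the posterior product is paired with the lower bound on the prior one;
      -- the second half of the theorem pairs the other two.
      ((A₁ + A₂) - (a₁ + a₂)) - (log M - log m)  ≤⟨ difference-lower (proj₂ posterior) (proj₁ prior) ⟩
      A - a                                      ≈⟨ I≈logVᶜ-logV g π (C₁ ×ᶜ C₂) ⟨
      I g π (C₁ ×ᶜ C₂)                           ∎)
  , (begin
      I g π (C₁ ×ᶜ C₂)                           ≈⟨ I≈logVᶜ-logV g π (C₁ ×ᶜ C₂) ⟩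
      A - a                                      ≤⟨ difference-upper (proj₁ posterior) (proj₂ prior) ⟩
      ((A₁ + A₂) - (a₁ + a₂)) + (log M - log m)  ≈⟨ +-cong I₁+I₂≈ logM≈ ⟨
      (I g₁ π₁ C₁ + I g₂ π₂ C₂) + logM           ∎)
  where
  open RealNumbers ℝ
  open Leakage ℝ
  open OrderedFieldProperties ℝ
  open SumMaxProperties ℝ
  open LeakageProperties ℝ
  open PartialOrderReasoning ≤-poset

  π₁ : Prior X₁
  π₁ = marginal₁ π

  π₂ : Prior X₂
  π₂ = marginal₂ π

  m M logM A A₁ A₂ a a₁ a₂ : Carrier
  m    = Mᵐⁱⁿ g₁ g₂ g π
  M    = Mᵐᵃˣ g₁ g₂ g π
  logM = log (M / m)
  A    = log (Vᶜ g π (C₁ ×ᶜ C₂))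
  A₁   = log (Vᶜ g₁ π₁ C₁)
  A₂   = log (Vᶜ g₂ π₂ C₂)
  a    = log (V g π)
  a₁   = log (V g₁ π₁)
  a₂   = log (V g₂ π₂)

  0<m : 0# < m
  0<m = Mᵐⁱⁿ-pos g₁ g₂ g joint π supported 0<V

  0<M : 0# < M
  0<M = Mᵐᵃˣ-pos g₁ g₂ g joint π supported 0<V

  V~ : Between m M (V g π) (V g₁ π₁ * V g₂ π₂)
  V~ = V-between g₁ g₂ g joint π supported 0<V

  -- Only the joint vulnerability is assumed positive; the lower bound `m * V g π` passes this to
  -- the product, and nonnegativity then to each factor.
  0<V₁V₂ : 0# < V g₁ π₁ * V g₂ π₂
  0<V₁V₂ = <-≤-trans (*-pos 0<m 0<V) (proj₁ V~)

  0<V₁ : 0# < V g₁ π₁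
  0<V₁ = *-pos⁻ˡ (V-nonneg g₁ π₁) 0<V₁V₂

  0<V₂ : 0# < V g₂ π₂
  0<V₂ = *-pos⁻ʳ (V-nonneg g₂ π₂) 0<V₁V₂

  prior : (log m + a ≤ a₁ + a₂) × (a₁ + a₂ ≤ log M + a)
  prior = log-between 0<m 0<M 0<V 0<V₁ 0<V₂ V~

  posterior : (log m + A ≤ A₁ + A₂) × (A₁ + A₂ ≤ log M + A)
  posterior = log-between 0<m 0<M
    (<-≤-trans 0<V (V≤Vᶜ g π (C₁ ×ᶜ C₂)))
    (<-≤-trans 0<V₁ (V≤Vᶜ g₁ π₁ C₁))
    (<-≤-trans 0<V₂ (V≤Vᶜ g₂ π₂ C₂))
    (Vᶜ-between g₁ g₂ g joint π supported 0<V C₁ C₂)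

  logM≈ : logM ≈ log M - log m
  logM≈ = log-/ 0<M 0<m

  I₁+I₂≈ : I g₁ π₁ C₁ + I g₂ π₂ C₂ ≈ (A₁ + A₂) - (a₁ + a₂)
  I₁+I₂≈ = trans (+-cong (I≈logVᶜ-logV g₁ π₁ C₁) (I≈logVᶜ-logV g₂ π₂ C₂))
                 (sym ([x+y]-[u+v]≈[x-u]+[y-v] A₁ A₂ a₁ a₂))
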